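{- Let $h$ be the morphism on $\{0,1,2\}^*$ defined by $h(0)=01$, $h(1)=21$, $h(2)=0$, and let $\mathbf{p}$ be the infinite fixed point of $h$ beginning with $0$. There is a deterministic finite automaton with output, with 144 states, which on input the $P4$ representation of a positive integer $n$ (most significant digit first) outputs the abelian complexity of $\mathbf{p}$ at $n$, i.e. the number of distinct Parikh vectors of length-$n$ factors of $\mathbf{p}$.
   Context: Define $X_1=1$, $X_2=2$, $X_3=4$, $X_4=7$, and $X_n=X_{n-1}+X_{n-2}+X_{n-4}$ for $n\geq 5$ (so $X_n=1,2,4,7,12,21,37,65,114,\dots$). Every natural number $N$ has a unique representation $N=\sum_{i=1}^{t}e_iX_i$ with $e_i\in\{0,1\}$, $e_t=1$ (empty for $N=0$), such that the binary string $e_te_{t-1}\cdots e_1$ contains no occurrence of $111$ or $1101$; this is the greedy representation, and the string $e_t\cdots e_1$ is called the $P4$ representation of $N$. The Parikh vector of a word $x$ over $\{0,1,2\}$ is $(|x|_0,|x|_1,|x|_2)$, where $|x|_a$ counts occurrences of $a$ in $x$. -}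

module Defs where

open import Data.Nat using (ℕ; zero; suc; _+_; _*_)
open import Data.Fin using (Fin; zero; suc; toℕ)
open import Data.List using (List; []; _∷_; _++_; concatMap; map; length; upTo)
open import Data.Product using (_×_; _,_; Σ; ∃)
open import Data.Empty using (⊥)
open import Relation.Binary.PropositionalEquality using (_≡_)
open import Relation.Nullary using (¬_)
open import Data.List.Membership.Propositional using (_∈_)
open import Data.List.Relation.Unary.Unique.Propositional using (Unique)

Letter : Set
Letter = Fin 3

l0 l1 l2 : Letter
l0 = zero
l1 = suc zero
l2 = suc (suc zero)

hL : Letter → List Letter
hL zero             = l0 ∷ l1 ∷ []
hL (suc zero)       = l2 ∷ l1 ∷ []
hL (suc (suc zero)) = l0 ∷ []

h : List Letter → List Letter
h = concatMap hL

hIter : ℕ → List Letter → List Letter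
hIter zero    w = w
hIter (suc k) w = h (hIter k w)

nth : List Letter → ℕ → Letter
nth []       _       = l0
nth (a ∷ w)  zero    = a
nth (a ∷ w)  (suc i) = nth w i

-- The infinite fixed point p = lim h^k(0) of h beginning with 0, as a
-- function from positions (0-indexed) to letters.  Since h^k(0) is a
-- prefix of h^(k+1)(0) and |h^k(0)| ≥ k+1, position i of p is position i
-- of h^(i+1)(0) (the default of nth is never used).
p : ℕ → Letter
p i = nth (hIter (suc i) (l0 ∷ [])) i

factor : ℕ → ℕ → List Letter
factor i n = map (λ j → p (i + j)) (upTo n)

count : Letter → List Letter → ℕ
count a []      = 0
count a (b ∷ w) with a Data.Fin.≟ b
... | Relation.Nullary.yes _ = suc (count a w)
... | Relation.Nullary.no  _ = count a w

Parikh : Set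
Parikh = ℕ × ℕ × ℕ

parikh : List Letter → Parikh
parikh x = count l0 x , count l1 x , count l2 x

IsAbelianComplexity : ℕ → ℕ → Set
IsAbelianComplexity n k =
  Σ (List Parikh) λ L →
    Unique L
    × (∀ v → v ∈ L → ∃ λ i → parikh (factor i n) ≡ v)
    × (∀ i → parikh (factor i n) ∈ L)
    × length L ≡ k

-- X_1 = 1, X_2 = 2, X_3 = 4, X_4 = 7, X_n = X_{n-1} + X_{n-2} + X_{n-4}
-- (X 0 is unused and set to 0)
X : ℕ → ℕ
X zero = 0
X (suc zero) = 1
X (suc (suc zero)) = 2
X (suc (suc (suc zero))) = 4
X (suc (suc (suc (suc zero)))) = 7
X (suc (suc (suc (suc (suc n))))) =
  X (suc (suc (suc (suc n)))) + X (suc (suc (suc n))) + X (suc n)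

Bit : Set
Bit = Fin 2

b0 b1 : Bit
b0 = zero
b1 = suc zero

val : List Bit → ℕ
val []       = 0
val (e ∷ es) = toℕ e * X (suc (length es)) + val es

NoFactor : List Bit → List Bit → Set
NoFactor u w = ∀ xs ys → ¬ (w ≡ xs ++ u ++ ys)

IsP4Rep : ℕ → List Bit → Set
IsP4Rep N w =
  (∃ λ rest → w ≡ b1 ∷ rest)
  × NoFactor (b1 ∷ b1 ∷ b1 ∷ []) w
  × NoFactor (b1 ∷ b1 ∷ b0 ∷ b1 ∷ []) w
  × val w ≡ N

record DFAO (Q : ℕ) : Set where
  field
    start  : Fin Q
    δ      : Fin Q → Bit → Fin Q
    output : Fin Q → ℕ

run : ∀ {Q} → DFAO Q → Fin Q → List Bit → Fin Q
run M q []       = q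
run M q (e ∷ es) = run M (DFAO.δ M q e) es

eval : ∀ {Q} → DFAO Q → List Bit → ℕ
eval M w = DFAO.output M (run M (DFAO.start M) w)

{-# OPTIONS --safe #-}

-- Let P i be the Parikh vector of the prefix of p of length i, and M the incidence matrix of h.
-- To a word w attach the vector r with r(we) = M r(w) + e (1, 0, 0); its coordinates sum to
-- val w, so that the factors of length val w correspond to the differences P j − P i − r(w)
-- with coordinate sum 0.  Consider the set S(w) of all triples (p i, p j, P j − P i − r(w))
-- whose coordinate sum lies in the window [−2, 3].  As p = h(p), every pair of positions
-- arises from a pair of parent positions, and S(we) is obtained from S(w) by passing to children
-- and discarding what leaves the window: parents outside the window have no children inside,
-- because positions and their blocks are ordered in the same way.  M is contracting
-- transversally to its dominant eigenvector, so only finitely many sets occur; a search run by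
-- the type checker finds them all (758 together with the part of the word relevant for the
-- forbidden factors), and they are compatible with an automaton with 142 states.

module Submission where

open import Defs
open import Data.Bool using (Bool; true; false; _∧_; _∨_; if_then_else_)
open import Data.Bool.Properties using (∧-conicalˡ; ∧-conicalʳ)
open import Data.Fin as Fin using (Fin; zero; suc; toℕ)
open import Data.Integer as ℤ using (ℤ; +_; ∣_∣)
import Data.Integer.Properties as ℤ
import Data.Integer.Tactic.RingSolver as ℤSolver
open import Data.List as List using
  (List; []; _∷_; _++_; _∷ʳ_; map; concat; concatMap; foldr; filter; length;
  deduplicate; derun; merge; take; upTo; applyUpTo)
import Data.List.Properties as List
import Data.List.Membership.DecPropositional as DecMembership
open import Data.List.Membership.Propositional using (_∈_; find; lose)
open import Data.List.Membership.Propositional.Properties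
open import Data.List.Relation.Binary.Permutation.Propositional using
  (_↭_; ↭-refl; ↭-sym; ↭-trans; module PermutationReasoning)
import Data.List.Relation.Binary.Permutation.Propositional.Properties as ↭
open import Data.List.Relation.Unary.All as All using (All; []; _∷_)
import Data.List.Relation.Unary.All.Properties as All
open import Data.List.Relation.Unary.Any using (here; there)
open import Data.List.Relation.Unary.Unique.DecPropositional.Properties using (deduplicate-!)
open import Data.List.Relation.Unary.Unique.Propositional using (Unique; []; _∷_)
open import Data.Nat as ℕ using (ℕ; zero; suc; _≤_; _<_; _≥_; z≤n; s≤s)
open import Data.Nat.DivMod using (_mod_)
open import Data.Nat.GeneralisedArithmetic using (fold)
import Data.Nat.Properties as ℕ
import Data.Nat.Tactic.RingSolver as ℕSolver
open import Data.Product using (Σ; _×_; _,_; proj₁; proj₂; uncurry; ∃; ∃₂; ∃-syntax)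
open import Data.Product.Properties using (,-injective)
open import Data.Sum using (inj₁; inj₂)
open import Data.Unit using (⊤; tt)
open import Function using (_∘_; id)
open import Relation.Binary.Definitions using (DecidableEquality)
open import Relation.Binary.PropositionalEquality using
  (_≡_; refl; sym; trans; cong; cong₂; subst; subst₂;
  module ≡-Reasoning)
open import Relation.Nullary using (¬_; yes; no; contradiction)
open import Relation.Nullary.Decidable using (Dec; does; map′; from-yes; _×-dec_; _→-dec_)
open import Relation.Unary using (Decidable)

-- The fixed point of h and its blocks

infixl 6 _+ᵖ_

_+ᵖ_ : Parikh → Parikh → Parikh
(x , y , z) +ᵖ (x′ , y′ , z′) = x ℕ.+ x′ , y ℕ.+ y′ , z ℕ.+ z′

imageᵖ : Parikh → Parikh
imageᵖ (x , y , z) = x ℕ.+ z , x ℕ.+ y , y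

totalᵖ : Parikh → ℕ
totalᵖ (x , y , z) = x ℕ.+ y ℕ.+ z

cong₃ : ∀ {A : Set} {x x′ y y′ z z′ : A} → x ≡ x′ → y ≡ y′ → z ≡ z′ → (x , y , z) ≡ (x′ , y′ , z′)
cong₃ refl refl refl = refl

count-++ : ∀ a u v → count a (u ++ v) ≡ count a u ℕ.+ count a v
count-++ a []      v = refl
count-++ a (b ∷ u) v with a Fin.≟ b
... | yes _ = cong suc (count-++ a u v)
... | no  _ = count-++ a u v

parikh-++ : ∀ u v → parikh (u ++ v) ≡ parikh u +ᵖ parikh v
parikh-++ u v = cong₃ (count-++ l0 u v) (count-++ l1 u v) (count-++ l2 u v)

totalᵖ-parikh : ∀ u → totalᵖ (parikh u) ≡ length u
totalᵖ-parikh []                       = refl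
totalᵖ-parikh (zero ∷ u)               = cong suc (totalᵖ-parikh u)
totalᵖ-parikh (suc zero ∷ u)           = trans (move (count l0 u) _ _) (cong suc (totalᵖ-parikh u))
  where
  move : ∀ x y z → x ℕ.+ suc y ℕ.+ z ≡ suc (x ℕ.+ y ℕ.+ z)
  move = ℕSolver.solve-∀
totalᵖ-parikh (suc (suc zero) ∷ u)     = trans (ℕ.+-suc _ _) (cong suc (totalᵖ-parikh u))

parikh-hL : ∀ a → parikh (hL a) ≡ imageᵖ (parikh (a ∷ []))
parikh-hL zero             = refl
parikh-hL (suc zero)       = refl
parikh-hL (suc (suc zero)) = refl

imageᵖ-+ : ∀ u v → imageᵖ (u +ᵖ v) ≡ imageᵖ u +ᵖ imageᵖ v
imageᵖ-+ (x , y , z) (x′ , y′ , z′) = cong₃ (interchange x x′ z z′) (interchange x x′ y y′) refl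
  where
  interchange : ∀ a b c d → (a ℕ.+ b) ℕ.+ (c ℕ.+ d) ≡ (a ℕ.+ c) ℕ.+ (b ℕ.+ d)
  interchange = ℕSolver.solve-∀

parikh-h : ∀ u → parikh (h u) ≡ imageᵖ (parikh u)
parikh-h []      = refl
parikh-h (a ∷ u) = begin
  parikh (hL a ++ h u)                             ≡⟨ parikh-++ (hL a) (h u) ⟩
  parikh (hL a) +ᵖ parikh (h u)                    ≡⟨ cong₂ _+ᵖ_ (parikh-hL a) (parikh-h u) ⟩
  imageᵖ (parikh (a ∷ [])) +ᵖ imageᵖ (parikh u)    ≡⟨ imageᵖ-+ (parikh (a ∷ [])) (parikh u) ⟨
  imageᵖ (parikh (a ∷ []) +ᵖ parikh u)             ≡⟨ cong imageᵖ (parikh-++ (a ∷ []) u) ⟨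
  imageᵖ (parikh (a ∷ u))                          ∎
  where open ≡-Reasoning

++-injective : ∀ {A : Set} {u u′ v v′ : List A} →
               length u ≡ length u′ → u ++ v ≡ u′ ++ v′ → u ≡ u′ × v ≡ v′
++-injective {u = []}    {[]}     _   eq = refl , eq
++-injective {u = a ∷ u} {b ∷ u′} len eq =
  let a≡b , eq′   = List.∷-injective eq
      u≡u′ , v≡v′ = ++-injective (ℕ.suc-injective len) eq′
  in cong₂ _∷_ a≡b u≡u′ , v≡v′

length-factor : ∀ i n → length (factor i n) ≡ n
length-factor i n = trans (List.length-map _ (upTo n)) (List.length-upTo n)

factor-∷ʳ : ∀ i n → factor i (suc n) ≡ factor i n ++ p (i ℕ.+ n) ∷ []
factor-∷ʳ i n = begin
  map f (upTo (suc n))        ≡⟨ List.map-upTo f (suc n) ⟩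
  applyUpTo f (suc n)         ≡⟨ List.applyUpTo-∷ʳ f n ⟨
  applyUpTo f n ∷ʳ f n        ≡⟨ cong (_∷ʳ f n) (List.map-upTo f n) ⟨
  map f (upTo n) ∷ʳ f n       ∎
  where
  open ≡-Reasoning
  f = λ j → p (i ℕ.+ j)

factor-+ : ∀ i m n → factor i (m ℕ.+ n) ≡ factor i m ++ factor (i ℕ.+ m) n
factor-+ i m zero    = begin
  factor i (m ℕ.+ 0)    ≡⟨ cong (factor i) (ℕ.+-identityʳ m) ⟩
  factor i m            ≡⟨ List.++-identityʳ (factor i m) ⟨
  factor i m ++ []      ∎
  where open ≡-Reasoning
factor-+ i m (suc n) = begin
  factor i (m ℕ.+ suc n)                                          ≡⟨ cong (factor i) (ℕ.+-suc m n) ⟩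
  factor i (suc (m ℕ.+ n))                                        ≡⟨ factor-∷ʳ i (m ℕ.+ n) ⟩
  factor i (m ℕ.+ n) ++ p (i ℕ.+ (m ℕ.+ n)) ∷ []
    ≡⟨ cong₂ _++_ (factor-+ i m n) (cong (λ k → p k ∷ []) (sym (ℕ.+-assoc i m n))) ⟩
  (factor i m ++ factor (i ℕ.+ m) n) ++ p (i ℕ.+ m ℕ.+ n) ∷ []    ≡⟨ List.++-assoc (factor i m) _ _ ⟩
  factor i m ++ (factor (i ℕ.+ m) n ++ p (i ℕ.+ m ℕ.+ n) ∷ [])
    ≡⟨ cong (factor i m ++_) (factor-∷ʳ (i ℕ.+ m) n) ⟨
  factor i m ++ factor (i ℕ.+ m) (suc n)                          ∎
  where open ≡-Reasoning

h-++ : ∀ u v → h (u ++ v) ≡ h u ++ h v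
h-++ = List.concatMap-++ hL

hIter-++ : ∀ k u v → hIter k (u ++ v) ≡ hIter k u ++ hIter k v
hIter-++ zero    u v = refl
hIter-++ (suc k) u v = trans (cong h (hIter-++ k u v)) (h-++ (hIter k u) (hIter k v))

hIter-h : ∀ k u → hIter k (h u) ≡ h (hIter k u)
hIter-h zero    u = refl
hIter-h (suc k) u = cong h (hIter-h k u)

0<length-hL : ∀ a → 0 < length (hL a)
0<length-hL zero             = s≤s z≤n
0<length-hL (suc zero)       = s≤s z≤n
0<length-hL (suc (suc zero)) = s≤s z≤n

length-h : ∀ u → length u ≤ length (h u)
length-h []      = z≤n
length-h (a ∷ u) = subst (suc (length u) ≤_) (sym (List.length-++ (hL a)))
  (ℕ.+-mono-≤ (0<length-hL a) (length-h u))

length-hIter : ∀ k u → length u ≤ length (hIter k u)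
length-hIter zero    u = ℕ.≤-refl
length-hIter (suc k) u = ℕ.≤-trans (length-hIter k u) (length-h (hIter k u))

approx : ℕ → List Letter
approx k = hIter k (l0 ∷ [])

-- `h` maps `0` to `01`, so the next iterate is the k-fold image of `01`. The iterates are therefore
-- prefixes of one another, each longer than the last.
approx-suc : ∀ k → approx (suc k) ≡ approx k ++ hIter k (l1 ∷ [])
approx-suc k = trans (sym (hIter-h k (l0 ∷ []))) (hIter-++ k (l0 ∷ []) (l1 ∷ []))

k<length-approx : ∀ k → k < length (approx k)
k<length-approx zero    = s≤s z≤n
k<length-approx (suc k) = subst (suc (suc k) ≤_) (begin
  length (approx k) ℕ.+ length v    ≡⟨ List.length-++ (approx k) ⟨
  length (approx k ++ v)            ≡⟨ cong length (approx-suc k) ⟨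
  length (approx (suc k))           ∎)
  (ℕ.≤-trans (ℕ.≤-reflexive (ℕ.+-comm 1 (suc k))) (ℕ.+-mono-≤ (k<length-approx k) (length-hIter k (l1 ∷ []))))
  where
  open ≡-Reasoning
  v = hIter k (l1 ∷ [])

nth-++ˡ : ∀ u v {i} → i < length u → nth (u ++ v) i ≡ nth u i
nth-++ˡ (a ∷ u) v {zero}  _         = refl
nth-++ˡ (a ∷ u) v {suc i} (s≤s i<u) = nth-++ˡ u v i<u

nth-approx : ∀ k d {i} → i < length (approx k) →
             i < length (approx (d ℕ.+ k)) × nth (approx (d ℕ.+ k)) i ≡ nth (approx k) i
nth-approx k zero    i<k = i<k , refl
nth-approx k (suc d) {i} i<k with nth-approx k d i<k
... | i<d , eq rewrite approx-suc (d ℕ.+ k) | List.length-++ (approx (d ℕ.+ k)) {hIter (d ℕ.+ k) (l1 ∷ [])} =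
  ℕ.≤-trans i<d (ℕ.m≤m+n _ _) , trans (nth-++ˡ (approx (d ℕ.+ k)) _ i<d) eq

-- By definition `p i` is read off iterate `suc i`. Of this iterate and iterate `k`, the shorter is
-- a prefix of the longer, whence the two cases.
p-approx : ∀ k {i} → i < length (approx k) → p i ≡ nth (approx k) i
p-approx k {i} i<k with ℕ.≤-total k (suc i)
... | inj₁ k≤i = subst (λ m → nth (approx m) i ≡ nth (approx k) i) (ℕ.m∸n+n≡m k≤i)
  (proj₂ (nth-approx k (suc i ℕ.∸ k) i<k))
... | inj₂ i≤k = sym (subst (λ m → nth (approx m) i ≡ p i) (ℕ.m∸n+n≡m i≤k)
  (proj₂ (nth-approx (suc i) (k ℕ.∸ suc i) (ℕ.<-trans (ℕ.n<1+n i) (k<length-approx (suc i))))))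

applyUpTo-nth : ∀ u (f : ℕ → Letter) → (∀ {i} → i < length u → f i ≡ nth u i) → applyUpTo f (length u) ≡ u
applyUpTo-nth []      f eq = refl
applyUpTo-nth (a ∷ u) f eq = cong₂ _∷_ (eq (s≤s z≤n)) (applyUpTo-nth u (f ∘ suc) (eq ∘ s≤s))

factor-approx : ∀ k → factor 0 (length (approx k)) ≡ approx k
factor-approx k = trans (List.map-upTo p (length (approx k))) (applyUpTo-nth (approx k) p (p-approx k))

factor-prefix : ∀ u {v m} → u ++ v ≡ factor 0 m → u ≡ factor 0 (length u)
factor-prefix u {v} {m} eq = proj₁ (++-injective (sym (length-factor 0 (length u))) (begin
  u ++ v                                                 ≡⟨ eq ⟩
  factor 0 m
    ≡⟨ cong (factor 0) (trans (sym (length-factor 0 m)) (trans (cong length (sym eq)) (List.length-++ u))) ⟩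
  factor 0 (length u ℕ.+ length v)                       ≡⟨ factor-+ 0 (length u) (length v) ⟩
  factor 0 (length u) ++ factor (length u) (length v)    ∎))
  where open ≡-Reasoning

-- The position in `p` at which the image of the letter at position `n` begins.
block : ℕ → ℕ
block n = length (h (factor 0 n))

-- The equation p = h(p) for finite prefixes: a prefix extends to an iterate `approx n`, whose image
-- is the next iterate and hence again a prefix of `p`.
h-fixes-prefix : ∀ n → h (factor 0 n) ≡ factor 0 (block n)
h-fixes-prefix n = factor-prefix (h (factor 0 n)) (begin
  h (factor 0 n) ++ h (factor n m)    ≡⟨ h-++ (factor 0 n) (factor n m) ⟨
  h (factor 0 n ++ factor n m)        ≡⟨ cong h (factor-+ 0 n m) ⟨
  h (factor 0 (n ℕ.+ m))              ≡⟨ cong (h ∘ factor 0) (ℕ.m+[n∸m]≡n (ℕ.<⇒≤ (k<length-approx n))) ⟩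
  h (factor 0 (length (approx n)))    ≡⟨ cong h (factor-approx n) ⟩
  approx (suc n)                      ≡⟨ factor-approx (suc n) ⟨
  factor 0 (length (approx (suc n)))  ∎)
  where
  open ≡-Reasoning
  m = length (approx n) ℕ.∸ n

h-factor-suc : ∀ n → h (factor 0 (suc n)) ≡ h (factor 0 n) ++ hL (p n)
h-factor-suc n = begin
  h (factor 0 (suc n))                  ≡⟨ cong h (factor-∷ʳ 0 n) ⟩
  h (factor 0 n ++ p n ∷ [])            ≡⟨ h-++ (factor 0 n) (p n ∷ []) ⟩
  h (factor 0 n) ++ (hL (p n) ++ [])    ≡⟨ cong (h (factor 0 n) ++_) (List.++-identityʳ (hL (p n))) ⟩
  h (factor 0 n) ++ hL (p n)            ∎
  where open ≡-Reasoning

block-suc : ∀ n → block (suc n) ≡ block n ℕ.+ length (hL (p n))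
block-suc n = trans (cong length (h-factor-suc n)) (List.length-++ (h (factor 0 n)))

factor-block : ∀ n → factor (block n) (length (hL (p n))) ≡ hL (p n)
factor-block n = proj₂ (++-injective refl (begin
  factor 0 (block n) ++ factor (block n) (length (hL (p n)))
    ≡⟨ factor-+ 0 (block n) (length (hL (p n))) ⟨
  factor 0 (block n ℕ.+ length (hL (p n)))                      ≡⟨ cong (factor 0) (block-suc n) ⟨
  factor 0 (block (suc n))                                      ≡⟨ h-fixes-prefix (suc n) ⟨
  h (factor 0 (suc n))                                          ≡⟨ h-factor-suc n ⟩
  h (factor 0 n) ++ hL (p n)
    ≡⟨ cong (_++ hL (p n)) (h-fixes-prefix n) ⟩
  factor 0 (block n) ++ hL (p n)                                ∎))
  where open ≡-Reasoning

block-mono : ∀ {m n} → m ≤ n → block m ≤ block n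
block-mono {m} {n} m≤n = subst (λ k → block m ≤ block k) (ℕ.m∸n+n≡m m≤n) (extend (n ℕ.∸ m))
  where
  extend : ∀ d → block m ≤ block (d ℕ.+ m)
  extend zero    = ℕ.≤-refl
  extend (suc d) = ℕ.≤-trans (extend d) (ℕ.≤-trans (ℕ.m≤m+n _ _) (ℕ.≤-reflexive (sym (block-suc (d ℕ.+ m)))))

-- The first block has length 2 and no block is empty. The strict inequality makes parents of
-- nonzero positions decrease, as the induction in `initial-complete` requires.
n<block : ∀ n → suc n < block (suc n)
n<block zero    = ℕ.≤-refl
n<block (suc n) = ℕ.≤-trans (ℕ.≤-reflexive (ℕ.+-comm 1 (suc (suc n))))
  (ℕ.≤-trans (ℕ.+-mono-≤ (n<block n) (0<length-hL (p (suc n)))) (ℕ.≤-reflexive (sym (block-suc (suc n)))))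

-- A view of a position as an offset inside a block. Being indexed by the position, it lets a match
-- rewrite the position into that form.
data Parent : ℕ → Set where
  parent : ∀ n d → d < length (hL (p n)) → Parent (block n ℕ.+ d)

parentOf : ∀ i → Parent i
parentOf zero    = parent 0 0 (s≤s z≤n)
parentOf (suc i) with parentOf i
... | parent n d d<len with suc d ℕ.<? length (hL (p n))
...   | yes 1+d<len = subst Parent (ℕ.+-suc (block n) d) (parent n (suc d) 1+d<len)
...   | no  1+d≮len = subst Parent (begin
  block (suc n) ℕ.+ 0                 ≡⟨ ℕ.+-identityʳ _ ⟩
  block (suc n)                       ≡⟨ block-suc n ⟩
  block n ℕ.+ length (hL (p n))       ≡⟨ cong (block n ℕ.+_) (ℕ.≤-antisym (ℕ.≮⇒≥ 1+d≮len) d<len) ⟩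
  block n ℕ.+ suc d                   ≡⟨ ℕ.+-suc (block n) d ⟩
  suc (block n ℕ.+ d)                 ∎) (parent (suc n) 0 (0<length-hL (p (suc n))))
  where open ≡-Reasoning

-- Position 0 is its own parent, so the bounds start at 1: positions below `m + 2` have parents
-- below `m + 1`.
parent-< : ∀ n d {m} → block n ℕ.+ d < suc (suc m) → n < suc m
parent-< zero    d _  = s≤s z≤n
parent-< (suc n) d lt = ℕ.≤-trans (n<block n) (ℕ.≤-trans (ℕ.m≤m+n _ d) (ℕ.s≤s⁻¹ lt))

nth-factor : ∀ i n {d} → d < n → nth (factor i n) d ≡ p (i ℕ.+ d)
nth-factor i n {d} d<n = begin
  nth (factor i n) d
    ≡⟨ cong (λ k → nth (factor i k) d) (ℕ.m+[n∸m]≡n d<n) ⟨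
  nth (factor i (suc d ℕ.+ m)) d
    ≡⟨ cong (λ u → nth u d) (trans (factor-+ i (suc d) m) (cong (_++ factor (i ℕ.+ suc d) m) (factor-∷ʳ i d))) ⟩
  nth ((factor i d ++ p (i ℕ.+ d) ∷ []) ++ _) d
    ≡⟨ cong (λ u → nth u d) (List.++-assoc (factor i d) _ _) ⟩
  nth (factor i d ++ p (i ℕ.+ d) ∷ _) d               ≡⟨ nth-length (factor i d) (length-factor i d) ⟩
  p (i ℕ.+ d)                                         ∎
  where
  open ≡-Reasoning
  m = n ℕ.∸ suc d
  nth-length : ∀ u {a v d} → length u ≡ d → nth (u ++ a ∷ v) d ≡ a
  nth-length []      refl = refl
  nth-length (b ∷ u) refl = nth-length u refl

p-block : ∀ n {d} → d < length (hL (p n)) → p (block n ℕ.+ d) ≡ nth (hL (p n)) d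
p-block n {d} d<len = trans (sym (nth-factor (block n) _ d<len)) (cong (λ u → nth u d) (factor-block n))

take-factor : ∀ i n {d} → d ≤ n → take d (factor i n) ≡ factor i d
take-factor i n {d} d≤n = begin
  take d (factor i n)
    ≡⟨ cong (λ k → take d (factor i k)) (ℕ.m+[n∸m]≡n d≤n) ⟨
  take d (factor i (d ℕ.+ m))                              ≡⟨ cong (take d) (factor-+ i d m) ⟩
  take d (factor i d ++ factor (i ℕ.+ d) m)
    ≡⟨ take-length (factor i d) (length-factor i d) ⟩
  factor i d                                               ∎
  where
  open ≡-Reasoning
  m = n ℕ.∸ d
  take-length : ∀ u {v : List Letter} {d} → length u ≡ d → take d (u ++ v) ≡ u
  take-length []      refl = refl
  take-length (a ∷ u) refl = cong (a ∷_) (take-length u refl)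

prefix : ℕ → Parikh
prefix n = parikh (factor 0 n)

prefix-+ : ∀ i n → prefix (i ℕ.+ n) ≡ prefix i +ᵖ parikh (factor i n)
prefix-+ i n = trans (cong parikh (factor-+ 0 i n)) (parikh-++ (factor 0 i) (factor i n))

totalᵖ-prefix : ∀ n → totalᵖ (prefix n) ≡ n
totalᵖ-prefix n = trans (totalᵖ-parikh (factor 0 n)) (length-factor 0 n)

prefix-suc : ∀ n → prefix (suc n) ≡ prefix n +ᵖ parikh (p n ∷ [])
prefix-suc n = trans (cong parikh (factor-∷ʳ 0 n)) (parikh-++ (factor 0 n) (p n ∷ []))

prefix-block : ∀ n → prefix (block n) ≡ imageᵖ (prefix n)
prefix-block n = trans (cong parikh (sym (h-fixes-prefix n))) (parikh-h (factor 0 n))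

prefix-in-block : ∀ n {d} → d < length (hL (p n)) →
                  prefix (block n ℕ.+ d) ≡ prefix (block n) +ᵖ parikh (take d (hL (p n)))
prefix-in-block n {d} d<len = trans (prefix-+ (block n) d)
  (cong (λ u → prefix (block n) +ᵖ parikh u)
    (trans (sym (take-factor (block n) _ (ℕ.<⇒≤ d<len))) (cong (take d) (factor-block n))))

-- Sets of pairs of positions and the automaton

-- The version of the standard library matches the first proof with refl, which is
-- far too slow on the large numbers compared below.
infixr 4 _×-≟_

_×-≟_ : ∀ {a b} {A : Set a} {B : Set b} →
        DecidableEquality A → DecidableEquality B → DecidableEquality (A × B)
(_≟₁_ ×-≟ _≟₂_) (x , y) (x′ , y′) =
  map′ (uncurry (cong₂ _,_)) ,-injective ((x ≟₁ x′) ×-dec (y ≟₂ y′))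

Vec3 : Set
Vec3 = ℤ × ℤ × ℤ

infixl 6 _⊕_ _⊝_

_⊕_ _⊝_ : Vec3 → Vec3 → Vec3
(x , y , z) ⊕ (x′ , y′ , z′) = x ℤ.+ x′ , y ℤ.+ y′ , z ℤ.+ z′
(x , y , z) ⊝ (x′ , y′ , z′) = x ℤ.- x′ , y ℤ.- y′ , z ℤ.- z′

total : Vec3 → ℤ
total (x , y , z) = x ℤ.+ y ℤ.+ z

image : Vec3 → Vec3
image (x , y , z) = x ℤ.+ z , x ℤ.+ y , y

Pair : Set
Pair = Letter × Letter × Vec3

excess : Pair → Vec3
excess (_ , _ , δ) = δ

_≟V_ : DecidableEquality Vec3
_≟V_ = ℤ._≟_ ×-≟ (ℤ._≟_ ×-≟ ℤ._≟_)

_≟P_ : DecidableEquality Pair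
_≟P_ = Fin._≟_ ×-≟ (Fin._≟_ ×-≟ _≟V_)

vec : Parikh → Vec3
vec (x , y , z) = + x , + y , + z

unit : Letter → Vec3
unit a = vec (parikh (a ∷ []))

-- The difference belonging to the starts of the two blocks: prefix vectors are multiplied by M, and
-- the reference vector also gains the new digit, which is subtracted here.
advance : Bit → Vec3 → Vec3
advance e δ = image δ ⊝ (+ toℕ e , + 0 , + 0)

-- The positions inside the block of a letter, each given by its letter and the Parikh vector of the
-- part of the block before it.
cuts : Letter → List (Letter × Vec3)
cuts zero             = (l0 , + 0 , + 0 , + 0) ∷ (l1 , + 1 , + 0 , + 0) ∷ []
cuts (suc zero)       = (l2 , + 0 , + 0 , + 0) ∷ (l1 , + 0 , + 0 , + 1) ∷ []
cuts (suc (suc zero)) = (l0 , + 0 , + 0 , + 0) ∷ []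

child : Bit → Vec3 → Letter × Vec3 → Letter × Vec3 → Pair
child e δ (a , u) (b , v) = a , b , advance e δ ⊕ v ⊝ u

children : Bit → Pair → List Pair
children e (a , b , δ) = List.cartesianProductWith (child e δ) (cuts a) (cuts b)

-- The window is wide enough for Separated to hold at its two ends.
Near : Pair → Set
Near x = ℤ.- (+ 2) ℤ.≤ total (excess x) × total (excess x) ℤ.≤ + 3

near? : Decidable Near
near? x = (ℤ.- (+ 2) ℤ.≤? total (excess x)) ×-dec (total (excess x) ℤ.≤? + 3)

-- Only the speed and the success of explore depend on key: on the pairs that occur it is
-- injective, so that sorting by it yields a canonical list.
key : Pair → ℕ
key (a , b , x , y , z) =
  toℕ a ℕ.+ 3 ℕ.* (toℕ b ℕ.+ 3 ℕ.* (shift x ℕ.+ 16 ℕ.* (shift y ℕ.+ 16 ℕ.* shift z)))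
  where
  shift : ℤ → ℕ
  shift x = ∣ x ℤ.+ + 8 ∣

Item : Set
Item = ℕ × Pair

_⋎_ : List Item → List Item → List Item
_⋎_ = merge (λ x y → proj₁ x ℕ.≤? proj₁ y)

-- Merge sort run as a binary counter: slot k is empty or holds 2^k items, and merging plays the
-- role of the carry. All recursion is structural, so the type checker can evaluate it.
push : List Item → List (List Item) → List (List Item)
push xs []                = xs ∷ []
push xs ([] ∷ yss)        = xs ∷ yss
push xs (ys@(_ ∷ _) ∷ yss) = [] ∷ push (xs ⋎ ys) yss

sort : List Item → List Item
sort xs = foldr _⋎_ [] (foldr (λ x → push (x ∷ [])) [] xs)

normalise : List Pair → List Pair
normalise xs = derun _≟P_ (map proj₂ (sort (map (λ x → key x , x) xs)))

step : Bit → List Pair → List Pair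
step e S = normalise (concatMap (λ x → filter near? (children e x)) S)

-- The set for the empty word. Leading zeros keep the reference vector at 0, so this set must be a
-- fixed point of the step on digit 0; five rounds from the pair of positions (0, 0) reach it, as
-- `initial-fixed` confirms.
initial : List Pair
initial = fold ((l0 , l0 , + 0 , + 0 , + 0) ∷ []) (step b0) 5

-- The longest suffix of the word read so far that is a proper prefix of 111 or 1101.
Suffix : Set
Suffix = Fin 4

pattern ε    = zero
pattern ‵1   = suc zero
pattern ‵11  = suc (suc zero)
pattern ‵110 = suc (suc (suc zero))

moves : Suffix → List (Bit × Suffix)
moves ε    = (b0 , ε) ∷ (b1 , ‵1) ∷ []
moves ‵1   = (b0 , ε) ∷ (b1 , ‵11) ∷ []
moves ‵11  = (b0 , ‵110) ∷ []
moves ‵110 = (b0 , ε) ∷ []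

Row : Set
Row = ℕ × ℕ × ℕ

row : List Row → ℕ → Row
row []       _       = 0 , 0 , 0
row (r ∷ _)  zero    = r
row (_ ∷ rs) (suc n) = row rs n

-- The minimised subset automaton; 0 fills in for missing transitions, and the states 142 and
-- 143 of the machine are unreachable.
table : List Row
table =
  (0 , 1 , 1) ∷ (2 , 3 , 3) ∷ (4 , 5 , 3) ∷ (6 , 0 , 4) ∷ (7 , 8 , 4) ∷ (9 , 10 , 3) ∷
  (11 , 0 , 4) ∷ (12 , 13 , 4) ∷ (14 , 10 , 4) ∷ (15 , 16 , 4) ∷ (17 , 0 , 4) ∷
  (18 , 19 , 3) ∷ (20 , 21 , 5) ∷ (22 , 23 , 5) ∷ (24 , 5 , 4) ∷ (25 , 26 , 4) ∷
  (27 , 10 , 4) ∷ (15 , 0 , 4) ∷ (28 , 29 , 4) ∷ (22 , 23 , 4) ∷ (30 , 31 , 4) ∷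
  (32 , 23 , 4) ∷ (33 , 34 , 4) ∷ (35 , 0 , 5) ∷ (36 , 8 , 5) ∷ (37 , 13 , 5) ∷
  (22 , 38 , 4) ∷ (39 , 16 , 5) ∷ (27 , 40 , 4) ∷ (41 , 23 , 4) ∷ (42 , 16 , 5) ∷
  (9 , 10 , 4) ∷ (43 , 44 , 4) ∷ (36 , 45 , 5) ∷ (30 , 10 , 4) ∷ (46 , 0 , 4) ∷
  (47 , 13 , 4) ∷ (48 , 21 , 5) ∷ (49 , 0 , 5) ∷ (50 , 26 , 5) ∷ (9 , 3 , 4) ∷ (51 , 34 , 3) ∷
  (52 , 53 , 5) ∷ (25 , 54 , 4) ∷ (55 , 10 , 5) ∷ (20 , 56 , 5) ∷ (57 , 58 , 4) ∷
  (59 , 21 , 5) ∷ (60 , 61 , 5) ∷ (62 , 0 , 4) ∷ (63 , 13 , 5) ∷ (7 , 45 , 4) ∷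
  (64 , 65 , 6) ∷ (22 , 38 , 5) ∷ (66 , 67 , 5) ∷ (68 , 16 , 6) ∷ (69 , 0 , 4) ∷
  (70 , 71 , 4) ∷ (72 , 73 , 4) ∷ (55 , 31 , 5) ∷ (74 , 75 , 5) ∷ (27 , 10 , 5) ∷
  (76 , 77 , 5) ∷ (78 , 21 , 5) ∷ (79 , 80 , 6) ∷ (81 , 23 , 5) ∷ (82 , 83 , 4) ∷
  (84 , 0 , 5) ∷ (85 , 53 , 6) ∷ (43 , 0 , 4) ∷ (27 , 86 , 4) ∷ (87 , 23 , 4) ∷
  (33 , 88 , 5) ∷ (89 , 0 , 5) ∷ (90 , 53 , 6) ∷ (81 , 38 , 4) ∷ (91 , 92 , 5) ∷
  (72 , 93 , 4) ∷ (94 , 61 , 6) ∷ (95 , 61 , 6) ∷ (32 , 38 , 4) ∷ (96 , 44 , 5) ∷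
  (42 , 97 , 5) ∷ (30 , 10 , 5) ∷ (98 , 0 , 4) ∷ (99 , 65 , 6) ∷ (100 , 101 , 4) ∷
  (102 , 103 , 4) ∷ (82 , 104 , 4) ∷ (105 , 0 , 5) ∷ (106 , 65 , 6) ∷ (48 , 107 , 5) ∷
  (108 , 23 , 5) ∷ (109 , 0 , 5) ∷ (110 , 75 , 6) ∷ (111 , 112 , 6) ∷ (50 , 54 , 5) ∷
  (48 , 56 , 5) ∷ (76 , 113 , 5) ∷ (114 , 80 , 6) ∷ (15 , 97 , 4) ∷ (115 , 0 , 5) ∷
  (7 , 116 , 4) ∷ (60 , 117 , 5) ∷ (118 , 0 , 5) ∷ (57 , 113 , 4) ∷ (95 , 112 , 7) ∷
  (119 , 120 , 4) ∷ (121 , 103 , 5) ∷ (98 , 0 , 5) ∷ (122 , 53 , 7) ∷ (111 , 112 , 7) ∷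
  (81 , 38 , 5) ∷ (123 , 93 , 5) ∷ (111 , 61 , 7) ∷ (36 , 0 , 5) ∷ (124 , 125 , 5) ∷
  (126 , 0 , 5) ∷ (42 , 0 , 5) ∷ (43 , 127 , 4) ∷ (128 , 0 , 6) ∷ (36 , 116 , 5) ∷
  (111 , 65 , 6) ∷ (82 , 129 , 5) ∷ (30 , 130 , 4) ∷ (131 , 0 , 4) ∷ (39 , 0 , 5) ∷
  (79 , 56 , 6) ∷ (132 , 0 , 5) ∷ (82 , 104 , 5) ∷ (100 , 104 , 4) ∷ (133 , 0 , 5) ∷
  (134 , 135 , 5) ∷ (25 , 136 , 4) ∷ (137 , 138 , 5) ∷ (72 , 73 , 5) ∷ (139 , 93 , 5) ∷
  (55 , 130 , 5) ∷ (140 , 23 , 4) ∷ (82 , 129 , 4) ∷ (133 , 141 , 5) ∷ (94 , 117 , 6) ∷ []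

machine : DFAO 144
machine = record
  { start  = zero
  ; δ      = λ q e → target e (row table (toℕ q)) mod 144
  ; output = λ q → proj₂ (proj₂ (row table (toℕ q)))
  }
  where
  target : Bit → Row → ℕ
  target zero       (n₀ , _  , _) = n₀
  target (suc zero) (_  , n₁ , _) = n₁

open DFAO machine

-- The first component is a hash of the set, which makes comparisons fail early.
State : Set
State = ℕ × Fin 144 × Suffix × List Pair

_≟S_ : DecidableEquality State
_≟S_ = ℕ._≟_ ×-≟ (Fin._≟_ ×-≟ (Fin._≟_ ×-≟ List.≡-dec _≟P_))

open DecMembership _≟S_ using (_∈?_)
open DecMembership _≟P_ using () renaming (_∈?_ to _∈ₚ?_)

state : Fin 144 → Suffix → List Pair → State
state q s S = foldr (λ x n → key x ℕ.+ 3 ℕ.* n) 0 S , q , s , S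

successors : State → List State
successors (_ , q , s , S) = map (λ (e , s′) → state (δ q e) s′ (step e S)) (moves s)

-- At the lower end of the window, everything before the block of j is below the window for
-- every position in the block of i; at the upper end, everything after the block of j is above
-- it.  As blocks are ordered, pairs outside the window then have no children inside.
Separated : Bit → Pair → Set
Separated e (a , b , δ) =
  (total δ ≡ ℤ.- (+ 2) → total (advance e δ) ℤ.≤ ℤ.- (+ 2)) ×
  (total δ ≡ + 3 → + 3 ℤ.≤ total (advance e (δ ⊕ unit b ⊝ unit a)))

separated? : ∀ e → Decidable (Separated e)
separated? e (a , b , δ) =
  ((total δ ℤ.≟ _) →-dec (_ ℤ.≤? _)) ×-dec ((total δ ℤ.≟ _) →-dec (_ ℤ.≤? _))

balanced? : Decidable (λ x → total (excess x) ≡ + 0)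
balanced? x = total (excess x) ℤ.≟ + 0

differences : List Pair → List Vec3
differences S = deduplicate _≟V_ (map excess (filter balanced? S))

Valid : State → Set
Valid (_ , q , s , S) =
  output q ≡ length (differences S) × All (λ (e , _) → All (Separated e) S) (moves s)

valid? : Decidable Valid
valid? (_ , q , s , S) =
  (output q ℕ.≟ length (differences S)) ×-dec All.all? (λ (e , _) → All.all? (separated? e) S) (moves s)

addNew : List State → State → List State → List State
addNew done t todo = if does (t ∈? done) ∨ does (t ∈? todo) then todo else t ∷ todo

explore : ℕ → List State → List State → Bool
explore _       done []         = true
explore zero    done (_ ∷ _)    = false
explore (suc n) done (t ∷ todo) =
  does (valid? t) ∧ explore n (t ∷ done) (foldr (addNew (t ∷ done)) todo (successors t))

-- The search itself, by evaluation. Each processed state costs one unit of fuel and is never queued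
-- twice, so 1000 units cover all states.
explored : explore 1000 [] (state zero ε initial ∷ []) ≡ true
explored = refl

initial-fixed : step b0 initial ≡ initial
initial-fixed = refl

origin∈initial : (l0 , l0 , + 0 , + 0 , + 0) ∈ initial
origin∈initial = from-yes ((l0 , l0 , + 0 , + 0 , + 0) ∈ₚ? initial)

-- Children of pairs

grow : Bit → Parikh → Parikh
grow e (x , y , z) = x ℕ.+ z ℕ.+ toℕ e , x ℕ.+ y , y

diff : Parikh → ℕ → ℕ → Vec3
diff r i j = vec (prefix j) ⊝ vec (prefix i) ⊝ vec r

pairAt : Parikh → ℕ → ℕ → Pair
pairAt r i j = p i , p j , diff r i j

shift-vector : ∀ P Q r u v →
  vec Q ⊝ vec P ⊝ vec r ⊕ vec v ⊝ vec u ≡ vec (Q +ᵖ v) ⊝ vec (P +ᵖ u) ⊝ vec r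
shift-vector (a , b , c) (a′ , b′ , c′) (x , y , z) (u₀ , u₁ , u₂) (v₀ , v₁ , v₂) =
  cong₃ (solve (+ a) (+ a′) (+ x) (+ u₀) (+ v₀)) (solve (+ b) (+ b′) (+ y) (+ u₁) (+ v₁))
           (solve (+ c) (+ c′) (+ z) (+ u₂) (+ v₂))
  where
  open import Data.Integer using (_+_; _-_)
  solve : ∀ a a′ x u v → a′ - a - x + v - u ≡ (a′ + v) - (a + u) - x
  solve = ℤSolver.solve-∀

diff-suc : ∀ r i j → diff r i j ⊕ unit (p j) ⊝ unit (p i) ≡ diff r (suc i) (suc j)
diff-suc r i j = trans (shift-vector (prefix i) (prefix j) r _ _)
  (sym (cong₂ (λ P Q → vec Q ⊝ vec P ⊝ vec r) (prefix-suc i) (prefix-suc j)))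

-- By p = h(p), the prefix ending where block `n` begins has Parikh vector M times that of the
-- prefix of length `n`; the reference vector obeys the recursion of `grow`.
advance-diff : ∀ e r i j → advance e (diff r i j) ≡ diff (grow e r) (block i) (block j)
advance-diff e r i j = trans (advance-vector (prefix i) (prefix j) r)
  (sym (cong₂ (λ P Q → vec Q ⊝ vec P ⊝ vec (grow e r)) (prefix-block i) (prefix-block j)))
  where
  open import Data.Integer using (_+_; _-_)
  sum₃ : ∀ a c a′ c′ x z e → (a′ - a - x) + (c′ - c - z) - e ≡ (a′ + c′) - (a + c) - (x + z + e)
  sum₃ = ℤSolver.solve-∀
  sum₂ : ∀ a b a′ b′ x y → (a′ - a - x) + (b′ - b - y) - + 0 ≡ (a′ + b′) - (a + b) - (x + y)
  sum₂ = ℤSolver.solve-∀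
  advance-vector : ∀ P Q r →
    advance e (vec Q ⊝ vec P ⊝ vec r) ≡ vec (imageᵖ Q) ⊝ vec (imageᵖ P) ⊝ vec (grow e r)
  advance-vector (a , b , c) (a′ , b′ , c′) (x , y , z) =
    cong₃ (sum₃ (+ a) (+ c) (+ a′) (+ c′) (+ x) (+ z) (+ toℕ e))
             (sum₂ (+ a) (+ b) (+ a′) (+ b′) (+ x) (+ y)) (ℤ.+-identityʳ _)

cut : Letter → ℕ → Letter × Vec3
cut a d = nth (hL a) d , vec (parikh (take d (hL a)))

cuts-cut : ∀ a → cuts a ≡ map (cut a) (upTo (length (hL a)))
cuts-cut zero             = refl
cuts-cut (suc zero)       = refl
cuts-cut (suc (suc zero)) = refl

∈-cuts⁻ : ∀ a {c} → c ∈ cuts a → ∃[ d ] d < length (hL a) × c ≡ cut a d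
∈-cuts⁻ a c∈ with ∈-map⁻ (cut a) (subst (_ ∈_) (cuts-cut a) c∈)
... | d , d∈ , eq = d , ∈-upTo⁻ d∈ , eq

∈-cuts⁺ : ∀ a {d} → d < length (hL a) → cut a d ∈ cuts a
∈-cuts⁺ a d< = subst (cut a _ ∈_) (sym (cuts-cut a)) (∈-map⁺ (cut a) (∈-upTo⁺ d<))

child-pairAt : ∀ e r i j {d d′} → d < length (hL (p i)) → d′ < length (hL (p j)) →
  child e (diff r i j) (cut (p i) d) (cut (p j) d′) ≡ pairAt (grow e r) (block i ℕ.+ d) (block j ℕ.+ d′)
child-pairAt e r i j d< d′< = cong₂ _,_ (sym (p-block i d<)) (cong₂ _,_ (sym (p-block j d′<)) (trans
  (cong (λ δ → δ ⊕ _ ⊝ _) (advance-diff e r i j)) (trans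
  (shift-vector (prefix (block i)) (prefix (block j)) (grow e r) _ _)
  (sym (cong₂ (λ P Q → vec Q ⊝ vec P ⊝ vec (grow e r)) (prefix-in-block i d<) (prefix-in-block j d′<))))))

∈-children⁻ : ∀ e r i j {x} → x ∈ children e (pairAt r i j) → ∃₂ λ i′ j′ → x ≡ pairAt (grow e r) i′ j′
∈-children⁻ e r i j x∈ with ∈-cartesianProductWith⁻ (child e (diff r i j)) (cuts (p i)) (cuts (p j)) x∈
... | _ , _ , u∈ , v∈ , refl with ∈-cuts⁻ (p i) u∈ | ∈-cuts⁻ (p j) v∈
... | d , d< , refl | d′ , d′< , refl = block i ℕ.+ d , block j ℕ.+ d′ , child-pairAt e r i j d< d′<

∈-children⁺ : ∀ e r i j {d d′} → d < length (hL (p i)) → d′ < length (hL (p j)) →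
              pairAt (grow e r) (block i ℕ.+ d) (block j ℕ.+ d′) ∈ children e (pairAt r i j)
∈-children⁺ e r i j d< d′< = subst (_∈ _) (child-pairAt e r i j d< d′<)
  (∈-cartesianProductWith⁺ (child e (diff r i j)) (∈-cuts⁺ (p i) d<) (∈-cuts⁺ (p j) d′<))

-- Membership after sorting and after one step

merge↭ : ∀ xs ys → xs ⋎ ys ↭ xs ++ ys
merge↭ = ↭.merge-↭ _

push-↭ : ∀ xs yss → concat (push xs yss) ↭ xs ++ concat yss
push-↭ xs []                  = ↭-refl
push-↭ xs ([] ∷ yss)          = ↭-refl
push-↭ xs (ys@(_ ∷ _) ∷ yss)  = begin
  concat (push (xs ⋎ ys) yss)    ↭⟨ push-↭ (xs ⋎ ys) yss ⟩
  (xs ⋎ ys) ++ concat yss        ↭⟨ ↭.++⁺ʳ (concat yss) (merge↭ xs ys) ⟩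
  (xs ++ ys) ++ concat yss       ≡⟨ List.++-assoc xs ys (concat yss) ⟩
  xs ++ ys ++ concat yss         ∎
  where open PermutationReasoning

sort-↭ : ∀ xs → sort xs ↭ xs
sort-↭ xs = ↭-trans (mergeAll-↭ (foldr (λ x → push (x ∷ [])) [] xs)) (pushAll-↭ xs)
  where
  mergeAll-↭ : ∀ yss → foldr _⋎_ [] yss ↭ concat yss
  mergeAll-↭ []         = ↭-refl
  mergeAll-↭ (ys ∷ yss) = ↭-trans (merge↭ ys _) (↭.++⁺ˡ ys (mergeAll-↭ yss))
  pushAll-↭ : ∀ xs → concat (foldr (λ x → push (x ∷ [])) [] xs) ↭ xs
  pushAll-↭ []       = ↭-refl
  pushAll-↭ (x ∷ xs) = ↭-trans (push-↭ (x ∷ []) (foldr (λ x → push (x ∷ [])) [] xs)) (_↭_.prep x (pushAll-↭ xs))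

∈-normalise⁺ : ∀ {x xs} → x ∈ xs → x ∈ normalise xs
∈-normalise⁺ x∈ = ∈-derun⁺ _≟P_ (∈-map⁺ proj₂ (↭.∈-resp-↭ (↭-sym (sort-↭ _)) (∈-map⁺ (λ x → key x , x) x∈)))

∈-normalise⁻ : ∀ {x} xs → x ∈ normalise xs → x ∈ xs
∈-normalise⁻ xs x∈ with ∈-map⁻ proj₂ (∈-derun⁻ _≟P_ _ x∈)
... | _ , y∈ , refl with ∈-map⁻ (λ x → key x , x) (↭.∈-resp-↭ (sort-↭ (map (λ x → key x , x) xs)) y∈)
... | _ , z∈ , refl = z∈

∈-step⁺ : ∀ e {S x y} → x ∈ S → y ∈ children e x → Near y → y ∈ step e S
∈-step⁺ e {S} x∈ y∈ near =
  ∈-normalise⁺ (∈-concatMap⁺ (λ x → filter near? (children e x)) (lose x∈ (∈-filter⁺ near? y∈ near)))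

∈-step⁻ : ∀ e {S y} → y ∈ step e S → ∃[ x ] x ∈ S × y ∈ children e x
∈-step⁻ e {S} y∈ with find (∈-concatMap⁻ (λ x → filter near? (children e x)) (∈-normalise⁻ _ y∈))
... | x , x∈ , y∈′ = x , x∈ , proj₁ (∈-filter⁻ near? y∈′)

-- Soundness and completeness of the sets of pairs

Sound : Parikh → List Pair → Set
Sound r S = ∀ {x} → x ∈ S → ∃₂ λ i j → x ≡ pairAt r i j

-- The predicate limits the positions considered: none for the run on a word, an upper bound for the
-- induction that treats `initial`.
Complete : (ℕ → Set) → Parikh → List Pair → Set
Complete Q r S = ∀ i j → Q i → Q j → Near (pairAt r i j) → pairAt r i j ∈ S

step-sound : ∀ e r {S} → Sound r S → Sound (grow e r) (step e S)
step-sound e r sound y∈ with ∈-step⁻ e y∈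
... | x , x∈ , y∈′ with sound x∈
... | i , j , refl = ∈-children⁻ e r i j y∈′

total-diff : ∀ r i j → total (diff r i j) ≡ + j ℤ.- + i ℤ.- + totalᵖ r
total-diff r@(x , y , z) i j = begin
  total (diff r i j)
    ≡⟨ separate (prefix j) (prefix i) ⟩
  + totalᵖ (prefix j) ℤ.- + totalᵖ (prefix i) ℤ.- + totalᵖ r
    ≡⟨ cong₂ (λ a b → + a ℤ.- + b ℤ.- + totalᵖ r) (totalᵖ-prefix j) (totalᵖ-prefix i) ⟩
  + j ℤ.- + i ℤ.- + totalᵖ r                                             ∎
  where
  open ≡-Reasoning
  open import Data.Integer using (_+_; _-_; -_)
  rearrange : ∀ a b c a′ b′ c′ x y z →
    (a - a′ - x) + (b - b′ - y) + (c - c′ - z) ≡ (a + b + c) - (a′ + b′ + c′) - (x + y + z)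
  rearrange = ℤSolver.solve-∀
  separate : ∀ P Q → total (vec P ⊝ vec Q ⊝ vec r) ≡ + totalᵖ P - + totalᵖ Q - + totalᵖ r
  separate (a , b , c) (a′ , b′ , c′) = rearrange (+ a) (+ b) (+ c) (+ a′) (+ b′) (+ c′) (+ x) (+ y) (+ z)

-- Bounds on totals are written as `a − b`, which covers -2, 0 and 3 alike; adding `offset` to both
-- sides turns them into inequalities between natural numbers.
module _ (a b : ℕ) (r : Parikh) (i j : ℕ) where
  private
    offset : ℤ
    offset = + b ℤ.+ + i ℤ.+ + totalᵖ r

    lhs : + a ℤ.- + b ℤ.+ offset ≡ + (a ℕ.+ i ℕ.+ totalᵖ r)
    lhs = solve (+ a) (+ b) (+ i) (+ totalᵖ r)
      where
      open import Data.Integer using (_+_; _-_)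
      solve : ∀ a b i t → a - b + (b + i + t) ≡ a + i + t
      solve = ℤSolver.solve-∀

    rhs : total (diff r i j) ℤ.+ offset ≡ + (j ℕ.+ b)
    rhs = trans (cong (ℤ._+ offset) (total-diff r i j)) (solve (+ b) (+ i) (+ j) (+ totalᵖ r))
      where
      open import Data.Integer using (_+_; _-_)
      solve : ∀ b i j t → j - i - t + (b + i + t) ≡ j + b
      solve = ℤSolver.solve-∀

  ≤total⁻ : + a ℤ.- + b ℤ.≤ total (diff r i j) → a ℕ.+ i ℕ.+ totalᵖ r ≤ j ℕ.+ b
  ≤total⁻ le = ℤ.drop‿+≤+ (subst₂ ℤ._≤_ lhs rhs (ℤ.+-monoˡ-≤ offset le))

  ≤total⁺ : a ℕ.+ i ℕ.+ totalᵖ r ≤ j ℕ.+ b → + a ℤ.- + b ℤ.≤ total (diff r i j)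
  ≤total⁺ le = ℤ.≮⇒≥ λ lt →
    ℕ.<⇒≱ (ℤ.drop‿+<+ (subst₂ ℤ._<_ rhs lhs (ℤ.+-monoˡ-< offset lt))) le

  total≤⁻ : total (diff r i j) ℤ.≤ + a ℤ.- + b → j ℕ.+ b ≤ a ℕ.+ i ℕ.+ totalᵖ r
  total≤⁻ le = ℤ.drop‿+≤+ (subst₂ ℤ._≤_ rhs lhs (ℤ.+-monoˡ-≤ offset le))

  total≤⁺ : j ℕ.+ b ≤ a ℕ.+ i ℕ.+ totalᵖ r → total (diff r i j) ℤ.≤ + a ℤ.- + b
  total≤⁺ le = ℤ.≮⇒≥ λ lt →
    ℕ.<⇒≱ (ℤ.drop‿+<+ (subst₂ ℤ._<_ lhs rhs (ℤ.+-monoˡ-< offset lt))) le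

near⁺ : ∀ r i j → i ℕ.+ totalᵖ r ≤ j ℕ.+ 2 → j ≤ 3 ℕ.+ i ℕ.+ totalᵖ r → Near (pairAt r i j)
near⁺ r i j lo hi = ≤total⁺ 0 2 r i j lo , total≤⁺ 3 0 r i j (ℕ.≤-trans (ℕ.≤-reflexive (ℕ.+-identityʳ j)) hi)

near⁻ : ∀ r i j → Near (pairAt r i j) → i ℕ.+ totalᵖ r ≤ j ℕ.+ 2 × j ≤ 3 ℕ.+ i ℕ.+ totalᵖ r
near⁻ r i j (lo , hi) = ≤total⁻ 0 2 r i j lo , ℕ.≤-trans (ℕ.m≤m+n j 0) (total≤⁻ 3 0 r i j hi)

-- `closed` ensures that the positions at the edges of the window, with which `not-below` and
-- `not-above` compare `j`, satisfy `Q` as well.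
module _ (e : Bit) (r : Parikh) {S : List Pair} {Q : ℕ → Set}
         (closed : ∀ {i j} → Q i → j ≤ i ℕ.+ totalᵖ r → Q j)
         (separated : All (Separated e) S) (complete : Complete Q r S)
         where

  private
    N N′ : ℕ
    N  = totalᵖ r
    N′ = totalᵖ (grow e r)

    separated-at : ∀ i j → Q i → Q j → Near (pairAt r i j) → Separated e (pairAt r i j)
    separated-at i j qi qj near = All.lookup separated (complete i j qi qj near)

    below : ∀ i j → Q i → Q j → j ℕ.+ 2 ≡ i ℕ.+ N → block j ℕ.+ 2 ≤ block i ℕ.+ N′
    below i j qi qj eq = total≤⁻ 0 2 (grow e r) (block i) (block j)
      (subst (λ δ → total δ ℤ.≤ ℤ.- (+ 2)) (advance-diff e r i j)
        (proj₁ (separated-at i j qi qj near) (ℤ.≤-antisym (total≤⁺ 0 2 r i j (ℕ.≤-reflexive eq)) (proj₁ near))))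
      where
      near : Near (pairAt r i j)
      near = near⁺ r i j (ℕ.≤-reflexive (sym eq))
        (ℕ.≤-trans (ℕ.m≤m+n j 2) (ℕ.≤-trans (ℕ.≤-reflexive eq) (ℕ.m≤n+m (i ℕ.+ N) 3)))

    -- Adding the unit vectors of both letters moves from `i` and `j` to their successors, so this
    -- bound concerns the ends of the two blocks.
    above : ∀ i j → Q i → Q j → j ≡ 3 ℕ.+ i ℕ.+ N → 3 ℕ.+ block (suc i) ℕ.+ N′ ≤ block (suc j)
    above i j qi qj eq = ℕ.≤-trans (≤total⁻ 3 0 (grow e r) (block (suc i)) (block (suc j))
      (subst (λ δ → + 3 ℤ.≤ total δ)
        (trans (cong (advance e) (diff-suc r i j)) (advance-diff e r (suc i) (suc j)))
        (proj₂ (separated-at i j qi qj near)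
          (ℤ.≤-antisym (proj₂ near) (≤total⁺ 3 0 r i j (ℕ.≤-reflexive (trans (sym eq) (sym (ℕ.+-identityʳ j)))))))))
      (ℕ.≤-reflexive (ℕ.+-identityʳ _))
      where
      near : Near (pairAt r i j)
      near = near⁺ r i j
        (ℕ.≤-trans (ℕ.m≤n+m (i ℕ.+ N) 3) (ℕ.≤-trans (ℕ.≤-reflexive (sym eq)) (ℕ.m≤m+n j 2)))
        (ℕ.≤-reflexive eq)

    parents-near : ∀ i j d d′ → Q i → Q j → d < length (hL (p i)) → d′ < length (hL (p j)) →
                   Near (pairAt (grow e r) (block i ℕ.+ d) (block j ℕ.+ d′)) → Near (pairAt r i j)
    parents-near i j d d′ qi qj d< d′< near = near⁺ r i j (ℕ.≮⇒≥ not-below) (ℕ.≮⇒≥ not-above)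
      where
      open ℕ.≤-Reasoning
      I = block i ℕ.+ d
      J = block j ℕ.+ d′

      I+N′≤J+2 : I ℕ.+ N′ ≤ J ℕ.+ 2
      I+N′≤J+2 = proj₁ (near⁻ (grow e r) I J near)

      J≤3+I+N′ : J ≤ 3 ℕ.+ I ℕ.+ N′
      J≤3+I+N′ = proj₂ (near⁻ (grow e r) I J near)

      within : ∀ n {d} → d < length (hL (p n)) → block n ℕ.+ d < block (suc n)
      within n d< = ℕ.≤-trans (ℕ.+-monoʳ-< (block n) d<) (ℕ.≤-reflexive (sym (block-suc n)))

      not-below : ¬ (j ℕ.+ 2 < i ℕ.+ N)
      not-below lt = ℕ.<-irrefl refl (begin-strict
        J ℕ.+ 2                 <⟨ ℕ.+-monoˡ-< 2 (within j d′<) ⟩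
        block (suc j) ℕ.+ 2     ≤⟨ ℕ.+-monoˡ-≤ 2 (block-mono j<k) ⟩
        block k ℕ.+ 2           ≤⟨ below i k qi (closed qi (ℕ.m∸n≤m _ 2)) k+2≡i+N ⟩
        block i ℕ.+ N′          ≤⟨ ℕ.+-monoˡ-≤ N′ (ℕ.m≤m+n (block i) d) ⟩
        I ℕ.+ N′                ≤⟨ I+N′≤J+2 ⟩
        J ℕ.+ 2                 ∎)
        where
        -- The position that, paired with `i`, lies exactly on the lower edge; `j` precedes it, so
        -- the block of `j` ends no later than that of `k` begins.
        k = i ℕ.+ N ℕ.∸ 2
        k+2≡i+N : k ℕ.+ 2 ≡ i ℕ.+ N
        k+2≡i+N = ℕ.m∸n+n≡m (ℕ.≤-trans (ℕ.m≤n+m 2 j) (ℕ.<⇒≤ lt))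
        j<k : j < k
        j<k = ℕ.+-cancelʳ-< 2 j k (ℕ.<-≤-trans lt (ℕ.≤-reflexive (sym k+2≡i+N)))

      not-above : ¬ (3 ℕ.+ i ℕ.+ N < j)
      not-above lt = ℕ.<-irrefl refl (begin-strict
        J                               ≤⟨ J≤3+I+N′ ⟩
        3 ℕ.+ I ℕ.+ N′                  <⟨ ℕ.+-monoˡ-< N′ (ℕ.+-monoʳ-< 3 (within i d<)) ⟩
        3 ℕ.+ block (suc i) ℕ.+ N′      ≤⟨ above i k qi (closed qj (ℕ.≤-trans (ℕ.<⇒≤ lt) (ℕ.m≤m+n j N))) refl ⟩
        block (suc k)                   ≤⟨ block-mono lt ⟩
        block j                         ≤⟨ ℕ.m≤m+n (block j) d′ ⟩
        J                               ∎)
        where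
        -- The position on the upper edge; `j` follows it, so the block of `j` begins no earlier
        -- than that of `k` ends.
        k = 3 ℕ.+ i ℕ.+ N

  -- `Q` is asked of the parents alone, so a bound on positions may grow from parents to children.
  step-complete : ∀ {i j d d′} → Q i → Q j → d < length (hL (p i)) → d′ < length (hL (p j)) →
    let x = pairAt (grow e r) (block i ℕ.+ d) (block j ℕ.+ d′) in Near x → x ∈ step e S
  step-complete {i} {j} {d} {d′} qi qj d< d′< near =
    ∈-step⁺ e (complete i j qi qj (parents-near i j d d′ qi qj d< d′< near)) (∈-children⁺ e r i j d< d′<) near

Always : ℕ → Set
Always _ = ⊤

step-complete-always : ∀ e r {S} → All (Separated e) S → Complete Always r S →
                       Complete Always (grow e r) (step e S)
step-complete-always e r separated complete i j _ _ near with parentOf i | parentOf j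
... | parent i′ d d< | parent j′ d′ d′< =
  step-complete e r {Q = Always} (λ _ _ → tt) separated complete {i′} {j′} tt tt d< d′< near

zeroᵖ : Parikh
zeroᵖ = 0 , 0 , 0

initial-sound : Sound zeroᵖ initial
initial-sound = iterate 5
  where
  iterate : ∀ n → Sound zeroᵖ (fold ((l0 , l0 , + 0 , + 0 , + 0) ∷ []) (step b0) n)
  iterate zero    (here refl) = 0 , 0 , refl
  -- `grow b0 zeroᵖ` computes to `zeroᵖ`.
  iterate (suc n) x∈          = step-sound b0 zeroᵖ (iterate n) x∈

-- Induction on a bound for both positions: parents obey a smaller bound until only the pair (0, 0)
-- is left, and `initial-fixed` brings the children back into the same set.
initial-complete : All (Separated b0) initial → Complete Always zeroᵖ initial
initial-complete separated i j _ _ = upTo-complete (i ℕ.⊔ j) i j (s≤s (ℕ.m≤m⊔n i j)) (s≤s (ℕ.m≤n⊔m i j))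
  where
  upTo-complete : ∀ n → Complete (_< suc n) zeroᵖ initial
  upTo-complete zero    zero    zero    _         _         _ = origin∈initial
  upTo-complete zero    zero    (suc _) _         (s≤s ())  _
  upTo-complete zero    (suc _) _       (s≤s ())  _         _
  upTo-complete (suc n) i j i< j< near with parentOf i | parentOf j
  ... | parent i′ d d< | parent j′ d′ d′< = subst
    (pairAt zeroᵖ (block i′ ℕ.+ d) (block j′ ℕ.+ d′) ∈_) initial-fixed
    (step-complete b0 zeroᵖ {Q = _< suc n}
      -- The reference vector is 0 here, so closure is only about `j ≤ i`.
      (λ {i} i< j≤ → ℕ.≤-<-trans (ℕ.≤-trans j≤ (ℕ.≤-reflexive (ℕ.+-identityʳ i))) i<) separated (upTo-complete n)
      {i′} {j′} (parent-< i′ d i<) (parent-< j′ d′ j<) d< d′< near)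

-- From differences to Parikh vectors

∈-differences⁻ : ∀ S {δ} → δ ∈ differences S → ∃[ x ] x ∈ S × excess x ≡ δ × total δ ≡ + 0
∈-differences⁻ S δ∈ with ∈-map⁻ excess (∈-deduplicate⁻ _≟V_ _ δ∈)
... | x , x∈ , refl with ∈-filter⁻ balanced? x∈
... | x∈S , eq = x , x∈S , refl , eq

∈-differences⁺ : ∀ S {x} → x ∈ S → total (excess x) ≡ + 0 → excess x ∈ differences S
∈-differences⁺ S x∈ eq = ∈-deduplicate⁺ _≟V_ (∈-map⁺ excess (∈-filter⁺ balanced? x∈ eq))

module _ (r : Parikh) where
  private
    N = totalᵖ r

  diff-factor : ∀ i → diff r i (i ℕ.+ N) ≡ vec (parikh (factor i N)) ⊝ vec r
  diff-factor i = trans (cong (λ P → vec P ⊝ vec (prefix i) ⊝ vec r) (prefix-+ i N))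
    (cancel (prefix i) (parikh (factor i N)))
    where
    open import Data.Integer using (_+_; _-_)
    solve : ∀ a b x → a + b - a - x ≡ b - x
    solve = ℤSolver.solve-∀
    cancel : ∀ P Q → vec (P +ᵖ Q) ⊝ vec P ⊝ vec r ≡ vec Q ⊝ vec r
    cancel (a , b , c) (a′ , b′ , c′) = cong₃ (solve (+ a) (+ a′) _) (solve (+ b) (+ b′) _) (solve (+ c) (+ c′) _)

  balanced : ∀ i j → total (diff r i j) ≡ + 0 → j ≡ i ℕ.+ N
  balanced i j eq = trans (sym (ℕ.+-identityʳ j)) (ℕ.≤-antisym
    (total≤⁻ 0 0 r i j (ℤ.≤-reflexive eq)) (≤total⁻ 0 0 r i j (ℤ.≤-reflexive (sym eq))))

  total-diff-factor : ∀ i → total (diff r i (i ℕ.+ N)) ≡ + 0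
  total-diff-factor i = ℤ.≤-antisym
    (total≤⁺ 0 0 r i (i ℕ.+ N) (ℕ.≤-reflexive (ℕ.+-identityʳ _)))
    (≤total⁺ 0 0 r i (i ℕ.+ N) (ℕ.≤-reflexive (sym (ℕ.+-identityʳ _))))

  -- Adding the reference vector recovers a Parikh vector; the absolute values merely return to ℕ,
  -- since for realised differences the coordinates are nonnegative.
  restore : Vec3 → Parikh
  restore δ = let x , y , z = δ ⊕ vec r in ∣ x ∣ , ∣ y ∣ , ∣ z ∣

  restore-⊝ : ∀ P → restore (vec P ⊝ vec r) ≡ P
  restore-⊝ (a , b , c) = cong₃ (solve a (proj₁ r)) (solve b (proj₁ (proj₂ r))) (solve c (proj₂ (proj₂ r)))
    where
    solve : ∀ a x → ∣ + a ℤ.- + x ℤ.+ + x ∣ ≡ a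
    solve a x = cong ∣_∣ (cancel (+ a) (+ x))
      where
      open import Data.Integer using (_+_; _-_)
      cancel : ∀ a x → a - x + x ≡ a
      cancel = ℤSolver.solve-∀

  -- Total 0 forces `j = i + N`, so the balanced pairs are exactly the factors of length `N`, and
  -- their differences are the Parikh vectors translated by the reference vector.
  complexity : ∀ {S} → Sound r S → Complete Always r S → IsAbelianComplexity N (length (differences S))
  complexity {S} sound complete =
    map restore (differences S) , unique , realised , covers , List.length-map restore (differences S)
    where
    realise : ∀ {δ} → δ ∈ differences S → ∃[ i ] δ ≡ vec (parikh (factor i N)) ⊝ vec r
    realise δ∈ with ∈-differences⁻ S δ∈
    ... | x , x∈ , refl , eq with sound x∈
    ... | i , j , refl with balanced i j eq
    ... | refl = i , diff-factor i

    -- Absolute values are not injective in general, so both arguments are first realised by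
    -- factors.
    restore-injective : ∀ {δ δ′} → δ ∈ differences S → δ′ ∈ differences S → restore δ ≡ restore δ′ → δ ≡ δ′
    restore-injective δ∈ δ′∈ eq with realise δ∈ | realise δ′∈
    ... | i , refl | i′ , refl =
      cong (λ P → vec P ⊝ vec r) (trans (sym (restore-⊝ _)) (trans eq (restore-⊝ _)))

    unique-map : ∀ δs → (∀ {δ} → δ ∈ δs → δ ∈ differences S) → Unique δs → Unique (map restore δs)
    unique-map []       _   []           = []
    unique-map (δ ∷ δs) sub (δ∉ ∷ uniq) =
      All.map⁺ (All.tabulate λ δ′∈ eq → All.lookup δ∉ δ′∈ (restore-injective (sub (here refl)) (sub (there δ′∈)) eq))
      ∷ unique-map δs (sub ∘ there) uniq

    unique : Unique (map restore (differences S))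
    unique = unique-map (differences S) id (deduplicate-! _≟V_ _)

    realised : ∀ v → v ∈ map restore (differences S) → ∃ λ i → parikh (factor i N) ≡ v
    realised v v∈ with ∈-map⁻ restore v∈
    ... | δ , δ∈ , refl with realise δ∈
    ... | i , refl = i , sym (restore-⊝ _)

    covers : ∀ i → parikh (factor i N) ∈ map restore (differences S)
    covers i = subst (_∈ map restore (differences S))
      (trans (cong restore (diff-factor i)) (restore-⊝ _))
      (∈-map⁺ restore (∈-differences⁺ S
        (complete i (i ℕ.+ N) tt tt (near⁺ r i (i ℕ.+ N) (ℕ.m≤m+n _ 2) (ℕ.m≤n+m _ 3))) (total-diff-factor i)))

-- Numeration

reference : Parikh → List Bit → Parikh
reference r []       = r
reference r (e ∷ es) = reference (grow e r) es

-- What a vector contributes to the coordinate sum after `k` further digits.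
weight : ℕ → Parikh → ℕ
weight zero    v = totalᵖ v
weight (suc k) v = weight k (imageᵖ v)

weight-+ : ∀ k u v → weight k (u +ᵖ v) ≡ weight k u ℕ.+ weight k v
weight-+ zero    (x , y , z) (x′ , y′ , z′) = solve x y z x′ y′ z′
  where
  open import Data.Nat using (_+_)
  solve : ∀ x y z x′ y′ z′ → (x + x′) + (y + y′) + (z + z′) ≡ (x + y + z) + (x′ + y′ + z′)
  solve = ℕSolver.solve-∀
weight-+ (suc k) u v = trans (cong (weight k) (imageᵖ-+ u v)) (weight-+ k (imageᵖ u) (imageᵖ v))

-- X⁴ − X³ − X² − 1 is X + 1 times the characteristic polynomial of imageᵖ.
image⁴ : ∀ v → imageᵖ (imageᵖ (imageᵖ (imageᵖ v))) ≡ imageᵖ (imageᵖ (imageᵖ v)) +ᵖ imageᵖ (imageᵖ v) +ᵖ v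
image⁴ (x , y , z) = cong₃ (first x y z) (second x y z) (third x y z)
  where
  open import Data.Nat using (_+_)
  first : ∀ x y z → (x + z + y + (x + y)) + (x + z + (x + y)) ≡ (x + z + y + (x + y)) + (x + z + y) + x
  first = ℕSolver.solve-∀
  second : ∀ x y z → (x + z + y + (x + y)) + (x + z + y + (x + z + (x + y))) ≡
    (x + z + y + (x + z + (x + y))) + (x + z + (x + y)) + y
  second = ℕSolver.solve-∀
  third : ∀ x y z → x + z + y + (x + z + (x + y)) ≡ (x + z + (x + y)) + (x + y) + z
  third = ℕSolver.solve-∀

-- These are the lengths of the words h^k(0): four initial values agree, and `image⁴` gives the
-- recurrence of `X`.
weight-X : ∀ k → weight k (1 , 0 , 0) ≡ X (suc k)
weight-X 0 = refl
weight-X 1 = refl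
weight-X 2 = refl
weight-X 3 = refl
weight-X (suc (suc (suc (suc k)))) = begin
  weight (4 ℕ.+ k) v                                            ≡⟨ cong (weight k) (image⁴ v) ⟩
  weight k (imageᵖ (imageᵖ (imageᵖ v)) +ᵖ imageᵖ (imageᵖ v) +ᵖ v)
    ≡⟨ weight-+ k (imageᵖ (imageᵖ (imageᵖ v)) +ᵖ imageᵖ (imageᵖ v)) v ⟩
  weight k (imageᵖ (imageᵖ (imageᵖ v)) +ᵖ imageᵖ (imageᵖ v)) ℕ.+ weight k v
    ≡⟨ cong (ℕ._+ weight k v) (weight-+ k (imageᵖ (imageᵖ (imageᵖ v))) (imageᵖ (imageᵖ v))) ⟩
  weight (3 ℕ.+ k) v ℕ.+ weight (2 ℕ.+ k) v ℕ.+ weight k v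
    ≡⟨ cong₂ ℕ._+_ (cong₂ ℕ._+_ (weight-X (suc (suc (suc k)))) (weight-X (suc (suc k)))) (weight-X k) ⟩
  X (5 ℕ.+ k)                                                   ∎
  where
  open ≡-Reasoning
  v : Parikh
  v = 1 , 0 , 0

weight-digit : ∀ k (e : Bit) → weight k (toℕ e , 0 , 0) ≡ toℕ e ℕ.* X (suc k)
weight-digit k zero       = weight-zero k
  where
  weight-zero : ∀ k → weight k zeroᵖ ≡ 0
  weight-zero zero    = refl
  weight-zero (suc k) = weight-zero k
weight-digit k (suc zero) = trans (weight-X k) (sym (ℕ.+-identityʳ _))

grow-+ : ∀ e r → grow e r ≡ imageᵖ r +ᵖ (toℕ e , 0 , 0)
grow-+ e r = cong₃ refl (sym (ℕ.+-identityʳ _)) (sym (ℕ.+-identityʳ _))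

-- Stated for an arbitrary starting vector, because the induction consumes the word from its most
-- significant digit.
total-reference : ∀ r w → totalᵖ (reference r w) ≡ weight (length w) r ℕ.+ val w
total-reference r []       = sym (ℕ.+-identityʳ _)
total-reference r (e ∷ es) = begin
  totalᵖ (reference (grow e r) es)
    ≡⟨ total-reference (grow e r) es ⟩
  weight k (grow e r) ℕ.+ val es
    ≡⟨ cong (λ v → weight k v ℕ.+ val es) (grow-+ e r) ⟩
  weight k (imageᵖ r +ᵖ (toℕ e , 0 , 0)) ℕ.+ val es
    ≡⟨ cong (ℕ._+ val es) (weight-+ k (imageᵖ r) (toℕ e , 0 , 0)) ⟩
  weight k (imageᵖ r) ℕ.+ weight k (toℕ e , 0 , 0) ℕ.+ val es
    ≡⟨ cong (λ n → weight k (imageᵖ r) ℕ.+ n ℕ.+ val es) (weight-digit k e) ⟩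
  weight k (imageᵖ r) ℕ.+ toℕ e ℕ.* X (suc k) ℕ.+ val es
    ≡⟨ ℕ.+-assoc (weight k (imageᵖ r)) _ _ ⟩
  weight k (imageᵖ r) ℕ.+ val (e ∷ es)                                  ∎
  where
  open ≡-Reasoning
  k = length es

total-reference-zero : ∀ w → totalᵖ (reference zeroᵖ w) ≡ val w
total-reference-zero w = trans (total-reference zeroᵖ w) (cong (ℕ._+ val w) (weight-digit (length w) b0))

-- Admissible words and the exploration

Admissible : List Bit → Set
Admissible w = NoFactor (b1 ∷ b1 ∷ b1 ∷ []) w × NoFactor (b1 ∷ b1 ∷ b0 ∷ b1 ∷ []) w

admissible-drop : ∀ u {w} → Admissible (u ++ w) → Admissible w
admissible-drop u (no111 , no1101) = drop no111 , drop no1101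
  where
  drop : ∀ {v w} → NoFactor v (u ++ w) → NoFactor v w
  drop avoids xs ys refl = avoids (u ++ xs) ys (sym (List.++-assoc u xs _))

read : Suffix → List Bit
read ε    = []
read ‵1   = b1 ∷ []
read ‵11  = b1 ∷ b1 ∷ []
read ‵110 = b1 ∷ b1 ∷ b0 ∷ []

-- The remembered suffix stays in front of the unread digits. A digit without a move would complete
-- 111 or 1101 at the very front.
moves-complete : ∀ s e {es} → Admissible (read s ++ e ∷ es) →
                 ∃[ s′ ] (e , s′) ∈ moves s × Admissible (read s′ ++ es)
moves-complete ε    zero       ok            = ε , here refl , admissible-drop (b0 ∷ []) ok
moves-complete ε    (suc zero) ok            = ‵1 , there (here refl) , ok
moves-complete ‵1   zero       ok            = ε , here refl , admissible-drop (b1 ∷ b0 ∷ []) ok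
moves-complete ‵1   (suc zero) ok            = ‵11 , there (here refl) , ok
moves-complete ‵11  zero       ok            = ‵110 , here refl , ok
moves-complete ‵11  (suc zero) (no111 , _)   = contradiction refl (no111 [] _)
moves-complete ‵110 zero       ok            = ε , here refl , admissible-drop (b1 ∷ b1 ∷ b0 ∷ b0 ∷ []) ok
moves-complete ‵110 (suc zero) (_ , no1101)  = contradiction refl (no1101 [] _)

-- Correctness of the search and of the run

Certified : List State → Set
Certified V = ∀ {t} → t ∈ V → Valid t × (∀ {u} → u ∈ successors t → u ∈ V)

addNew-⊇ : ∀ done u todo {t} → t ∈ todo → t ∈ addNew done u todo
addNew-⊇ done u todo t∈ with does (u ∈? done) ∨ does (u ∈? todo)
... | true  = t∈
... | false = there t∈

addNew-∋ : ∀ done u todo → u ∈ done ++ addNew done u todo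
addNew-∋ done u todo with u ∈? done | u ∈? todo
... | yes u∈ | _      = ∈-++⁺ˡ u∈
... | no _   | yes u∈ = ∈-++⁺ʳ done u∈
... | no _   | no _   = ∈-++⁺ʳ done (here refl)

++-monoʳ : ∀ {t : State} done {todo todo′} → (t ∈ todo → t ∈ todo′) → t ∈ done ++ todo → t ∈ done ++ todo′
++-monoʳ done sub t∈ with ∈-++⁻ done t∈
... | inj₁ t∈done = ∈-++⁺ˡ t∈done
... | inj₂ t∈todo = ∈-++⁺ʳ done (sub t∈todo)

addAll-⊇ : ∀ done us todo {t} → t ∈ todo → t ∈ foldr (addNew done) todo us
addAll-⊇ done []       todo t∈ = t∈
addAll-⊇ done (u ∷ us) todo t∈ = addNew-⊇ done u _ (addAll-⊇ done us todo t∈)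

addAll-∋ : ∀ done us todo {t} → t ∈ us → t ∈ done ++ foldr (addNew done) todo us
addAll-∋ done (u ∷ us) todo (here refl) = addNew-∋ done u (foldr (addNew done) todo us)
addAll-∋ done (u ∷ us) todo (there t∈)  = ++-monoʳ done (addNew-⊇ done u _) (addAll-∋ done us todo t∈)

-- Invariant of the search: processed states are valid and their successors are processed or queued.
-- Once the queue is empty, the processed states are closed under successors.
explore-sound : ∀ n done todo → explore n done todo ≡ true →
  (∀ {t} → t ∈ done → Valid t × (∀ {u} → u ∈ successors t → u ∈ done ++ todo)) →
  ∃[ V ] Certified V × (∀ {t} → t ∈ done ++ todo → t ∈ V)
explore-sound n done [] eq certified =
  done , (λ t∈ → proj₁ (certified t∈) , shrink ∘ proj₂ (certified t∈)) , shrink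
  where
  shrink : ∀ {t} → t ∈ done ++ [] → t ∈ done
  shrink = subst (_ ∈_) (List.++-identityʳ done)
explore-sound zero    done (t ∷ todo) () certified
explore-sound (suc n) done (t ∷ todo) eq certified =
  let V , certifiedV , sub = explore-sound n done′ todo′ (∧-conicalʳ (does (valid? t)) _ eq) certified′
  in V , certifiedV , sub ∘ move
  where
  witness : ∀ {P : Set} (P? : Dec P) → does P? ≡ true → P
  witness (yes p) _ = p
  done′ = t ∷ done
  todo′ = foldr (addNew done′) todo (successors t)
  move : ∀ {u} → u ∈ done ++ t ∷ todo → u ∈ done′ ++ todo′
  move u∈ with ∈-++⁻ done u∈
  ... | inj₁ u∈done        = there (∈-++⁺ˡ u∈done)
  ... | inj₂ (here refl)   = here refl
  ... | inj₂ (there u∈todo) = ∈-++⁺ʳ done′ (addAll-⊇ done′ (successors t) todo u∈todo)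
  certified′ : ∀ {u} → u ∈ done′ → Valid u × (∀ {v} → v ∈ successors u → v ∈ done′ ++ todo′)
  certified′ (here refl) = witness (valid? t) (∧-conicalˡ _ _ eq) , addAll-∋ done′ (successors t) todo
  certified′ (there u∈)  = proj₁ (certified u∈) , move ∘ proj₂ (certified u∈)

-- Along the word the current state stays in `V`; its validity supplies the separation needed for
-- the next step and, at the end, the equality of output and number of differences.
run-complexity : ∀ {V} → Certified V → ∀ w {q s S r} → state q s S ∈ V →
  Sound r S → Complete Always r S → Admissible (read s ++ w) →
  IsAbelianComplexity (totalᵖ (reference r w)) (DFAO.output machine (run machine q w))
run-complexity certified [] {q} {s} {S} {r} t∈ sound complete ok =
  subst (IsAbelianComplexity (totalᵖ r)) (sym (proj₁ (proj₁ (certified t∈)))) (complexity r sound complete)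
run-complexity certified (e ∷ es) {q} {s} {S} {r} t∈ sound complete ok =
  let s′ , move , ok′ = moves-complete s e ok
      valid , next    = certified t∈
      separated       = All.lookup (proj₂ valid) move
  in run-complexity certified es (next (∈-map⁺ (λ (e , s′) → state (DFAO.δ machine q e) s′ (step e S)) move))
       (step-sound e r sound) (step-complete-always e r separated complete) ok′

certificate : ∃[ V ] Certified V × (∀ {t} → t ∈ state zero ε initial ∷ [] → t ∈ V)
certificate = explore-sound 1000 [] (state zero ε initial ∷ []) explored λ ()

theorem4 : Σ (DFAO 144) λ M →
    (n : ℕ) → n ≥ 1 → (w : List Bit) → IsP4Rep n w →
    IsAbelianComplexity n (eval M w)
theorem4 = machine , λ n _ w (_ , no111 , no1101 , val≡n) →
  let V , certified , sub = certificate
      start∈              = sub (here refl)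
  in subst (λ m → IsAbelianComplexity m (eval machine w)) (trans (total-reference-zero w) val≡n)
       (run-complexity certified w start∈ initial-sound
         -- The first move out of `ε` reads the digit 0, so validity of the starting state contains
         -- the separation that `initial` needs.
         (initial-complete (All.lookup (proj₂ (proj₁ (certified start∈))) (here refl))) (no111 , no1101))
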